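{- Let $G=(V,E,w)$ be a weighted undirected graph with non-negative integer edge weights and let $T=\{t_1,\dots,t_k\}\subseteq V$ be a set of $k$ terminals. For two vertices $v_1$ and $v_2$ of $G$ with $N(v_1)\setminus\{v_2\}=N(v_2)\setminus\{v_1\}$, where $w(v_1,v)=w(v_2,v)$ for all $v\in N(v_1)\setminus\{v_2\}$, there is at least one minimum multiterminal cut of $G$ with respect to $T$ in which $v_1$ and $v_2$ belong to the same block.
   Context: $N(v)$ denotes the set of vertices adjacent to $v$, and $w(u,v)$ is the weight of the edge $(u,v)$. A multiterminal cut for terminals $T=\{t_1,\dots,t_k\}$ (pairwise distinct vertices) is a partition of $V$ into $k$ disjoint non-empty blocks $V_1,\dots,V_k$ with $t_j\in V_j$ for all $j$; its weight is the sum of the weights of all edges whose two endpoints lie in different blocks. A minimum multiterminal cut is one of minimum weight.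
   Formalization: The two vertices are assumed not to be terminals; without this the claim fails, e.g. on the unit-weight path t₁–t₂–x with v₁=t₁, v₂=x, where the minimum cut has weight 1 but every cut with t₁ and x in one block has weight 2. -}

module Defs where

open import Algebra.Properties.CommutativeMonoid.Sum as Sum using ()
open import Data.Bool using (Bool; if_then_else_; _∧_; not)
open import Data.Fin using (Fin; _<?_)
open import Data.Fin.Properties using (any?)
open import Data.Fin.Subset using (Subset; _∈_; Nonempty)
open import Data.Fin.Subset.Properties using (_∈?_)
open import Data.Nat using (ℕ; _≤_)
open import Data.Nat.Properties using (+-0-commutativeMonoid)
open import Data.Product using (∃; _×_)
open import Data.Vec using (tabulate)
open import Relation.Binary.PropositionalEquality using (_≡_)
open import Relation.Nullary using (Dec; does)
open import Relation.Nullary.Decidable using (_×-dec_)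

open Sum +-0-commutativeMonoid using (sum-syntax)

-- Edges of weight 0 are still edges, so adjacency is kept separate from the
-- weights. The value of w on a non-edge is junk and is never used.
record WeightedGraph (n : ℕ) : Set where
  field
    edge     : Fin n → Fin n → Bool
    edge-sym : ∀ u v → edge u v ≡ edge v u
    w        : Fin n → Fin n → ℕ
    w-sym    : ∀ u v → w u v ≡ w v u

  N : Fin n → Subset n
  N v = tabulate (edge v)

record MultiterminalCut {n k : ℕ} (t : Fin k → Fin n) : Set where
  field
    block    : Fin k → Subset n
    nonempty : ∀ j → Nonempty (block j)
    disjoint : ∀ {i j v} → v ∈ block i → v ∈ block j → i ≡ j
    cover    : ∀ v → ∃ λ j → v ∈ block j
    terminal : ∀ j → t j ∈ block j

module _ {n k : ℕ} {t : Fin k → Fin n} where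

  SameBlock : MultiterminalCut t → Fin n → Fin n → Set
  SameBlock C u v = ∃ λ j → u ∈ block j × v ∈ block j
    where open MultiterminalCut C

  sameBlock? : ∀ C u v → Dec (SameBlock C u v)
  sameBlock? C u v = any? λ j → (u ∈? block j) ×-dec (v ∈? block j)
    where open MultiterminalCut C

  -- The test u < v makes each undirected edge count once. It discards
  -- loops, whose two ends always share a block.
  cutWeight : WeightedGraph n → MultiterminalCut t → ℕ
  cutWeight G C =
    ∑[ u < n ] ∑[ v < n ]
      (if does (u <? v) ∧ edge u v ∧ not (does (sameBlock? C u v))
       then w u v else 0)
    where open WeightedGraph G

  IsMinimum : WeightedGraph n → MultiterminalCut t → Set
  IsMinimum G C = ∀ (C′ : MultiterminalCut t) → cutWeight G C ≤ cutWeight G C′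

{-# OPTIONS --safe #-}
-- View cuts as labellings f : V → {1,…,k} fixing the terminals. Let f be a
-- minimum labelling, σ the transposition of v₁ and v₂, and f₁ (resp. f₂) the
-- labelling in which both vertices carry the label of v₁ (resp. v₂). Edge by
-- edge, f₁ and f₂ together cut no more than f and f ∘ σ together, and σ
-- preserves the weights because v₁ and v₂ are twins. Summing over ordered
-- pairs, so that σ can reindex the sum, the weights of f₁ and f₂ add up to at
-- most twice the minimum, so one of them is a minimum.
module Submission where

open import Defs
open import Algebra.Properties.CommutativeMonoid.Sum as Sum using ()
open import Data.Bool using (true; false; if_then_else_; _∧_; not)
open import Data.Bool.Properties using (if-∧; ⇔→≡)
open import Data.Fin using (Fin; zero; suc; _<?_; funToFin; finToFun)
open import Data.Fin.Permutation using (transpose; _⟨$⟩ʳ_)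
open import Data.Fin.Properties
  using (_≟_; any?; <-cmp; finToFun-funToFin)
open import Data.Fin.Subset using (_∈_; _-_)
open import Data.Fin.Subset.Properties using (x∈p∧x≢y⇒x∈p-y; p─q⊆p)
open import Data.List using (allFin)
open import Data.List.Extrema.Nat using (argmin; f[argmin]≤f[xs])
open import Data.List.Membership.Propositional.Properties using (∈-allFin)
import Data.List.Relation.Unary.All as All
open import Data.Nat using (ℕ; _+_; _≤_; _≥_; z≤n; s≤s; _≤?_)
open import Data.Nat.Properties
  using (+-0-commutativeMonoid; +-mono-≤; +-mono-<; +-comm; +-identityʳ;
         ≤-refl; ≤-reflexive; ≤-trans; ≰⇒>; <⇒≱; module ≤-Reasoning)
open import Data.Product using (∃; _×_; _,_; proj₁; proj₂)
open import Data.Sum as ⊎ using (_⊎_; inj₁; inj₂; reduce)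
open import Data.Vec using (tabulate)
open import Data.Vec.Properties using (lookup∘tabulate; []=⇒lookup; lookup⇒[]=)
open import Function using (_∘_; const; _⇔_; mk⇔; module Equivalence)
open import Function.Definitions using (Injective)
open import Relation.Binary using (tri<; tri≈; tri>)
open import Relation.Binary.PropositionalEquality
  using (_≡_; _≢_; _≗_; refl; sym; trans; cong; cong₂; subst; subst₂;
         module ≡-Reasoning)
open import Relation.Nullary using (does; yes; no; contradiction)
open import Relation.Nullary.Decidable using (dec-true; dec-false; does-⇔)

open Sum +-0-commutativeMonoid
  using (sum; sum-syntax; sum-cong-≗; ∑-distrib-+; ∑-comm; ∑-permute)

-- Sums over ordered pairs, and minima over finite function spaces.

m+n≤o+o⇒m≤o⊎n≤o : ∀ {m n} o → m + n ≤ o + o → m ≤ o ⊎ n ≤ o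
m+n≤o+o⇒m≤o⊎n≤o {m} {n} o le with m ≤? o | n ≤? o
... | yes m≤o | _       = inj₁ m≤o
... | no  _   | yes n≤o = inj₂ n≤o
... | no  m≰o | no  n≰o = contradiction le (<⇒≱ (+-mono-< (≰⇒> m≰o) (≰⇒> n≰o)))

∑-mono-≤ : ∀ {n} {f g : Fin n → ℕ} → (∀ i → f i ≤ g i) → sum f ≤ sum g
∑-mono-≤ {ℕ.zero}  f≤g = z≤n
∑-mono-≤ {ℕ.suc n} f≤g = +-mono-≤ (f≤g zero) (∑-mono-≤ (f≤g ∘ suc))

module _ {n : ℕ} where

  ∑∑ : (Fin n → Fin n → ℕ) → ℕ
  ∑∑ h = ∑[ u < n ] ∑[ v < n ] h u v

  ∑∑-cong : ∀ {h h′} → (∀ u v → h u v ≡ h′ u v) → ∑∑ h ≡ ∑∑ h′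
  ∑∑-cong eq = sum-cong-≗ λ u → sum-cong-≗ (eq u)

  ∑∑-mono-≤ : ∀ {h h′} → (∀ u v → h u v ≤ h′ u v) → ∑∑ h ≤ ∑∑ h′
  ∑∑-mono-≤ le = ∑-mono-≤ λ u → ∑-mono-≤ (le u)

  ∑∑-distrib-+ : ∀ h h′ → ∑∑ (λ u v → h u v + h′ u v) ≡ ∑∑ h + ∑∑ h′
  ∑∑-distrib-+ h h′ = trans
    (sum-cong-≗ λ u → ∑-distrib-+ (h u) (h′ u))
    (∑-distrib-+ (λ u → sum (h u)) (λ u → sum (h′ u)))

  ∑∑-permute : ∀ h π → ∑∑ h ≡ ∑∑ (λ u v → h (π ⟨$⟩ʳ u) (π ⟨$⟩ʳ v))
  ∑∑-permute h π = trans
    (∑-permute (λ u → sum (h u)) π)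
    (sum-cong-≗ λ u → ∑-permute (h (π ⟨$⟩ʳ u)) π)

  -- The strict upper triangle of the matrix `h`, matching the test in `cutWeight` that counts each
  -- edge once.
  above : (Fin n → Fin n → ℕ) → Fin n → Fin n → ℕ
  above h u v = if does (u <? v) then h u v else 0

  -- By trichotomy each off-diagonal entry lies in the upper triangle or in its transpose, and
  -- exchanging the sums makes the two equal. This links the sum over ordered pairs, which a
  -- permutation can reindex, to the sum defining the cut weight.
  ∑∑-above : ∀ h → (∀ u v → h u v ≡ h v u) → (∀ u → h u u ≡ 0) →
             ∑∑ h ≡ ∑∑ (above h) + ∑∑ (above h)
  ∑∑-above h h-sym h-diag = begin
    ∑∑ h                                      ≡⟨ ∑∑-cong split ⟩
    ∑∑ (λ u v → above h u v + above h v u)    ≡⟨ ∑∑-distrib-+ (above h) _ ⟩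
    ∑∑ (above h) + ∑∑ (λ u v → above h v u)   ≡⟨ cong (∑∑ (above h) +_) (∑-comm (above h)) ⟨
    ∑∑ (above h) + ∑∑ (above h)               ∎
    where
    open ≡-Reasoning
    split : ∀ u v → h u v ≡ above h u v + above h v u
    split u v with <-cmp u v
    ... | tri< u<v _ v≮u
      rewrite dec-true (u <? v) u<v | dec-false (v <? u) v≮u = sym (+-identityʳ _)
    ... | tri≈ u≮v refl _
      rewrite dec-false (u <? u) u≮v = h-diag u
    ... | tri> u≮v _ v<u
      rewrite dec-false (u <? v) u≮v | dec-true (v <? u) v<u = h-sym u v

-- Functions are coded by a finite type, so the minimum is a search through all codes. Decoding
-- inverts coding only pointwise, hence the congruence hypothesis on `c`.
minimal-function : ∀ {n k} (c : (Fin n → Fin k) → ℕ) →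
                   (∀ {f g} → f ≗ g → c f ≡ c g) →
                   Fin k → ∃ λ f → ∀ g → c f ≤ c g
minimal-function {n} {k} c c-cong j₀ = finToFun best , λ g →
  subst (c (finToFun best) ≤_) (c-cong (finToFun-funToFin g))
    (All.lookup (f[argmin]≤f[xs] {f = c ∘ finToFun} ⊤ codes) (∈-allFin (funToFin g)))
  where
  -- The default value of `argmin`; `j₀` is what makes a first function available.
  ⊤     = funToFin {n} (const j₀)
  codes = allFin _
  best  = argmin (c ∘ finToFun) ⊤ codes

-- Translation between cuts and labellings.

module _ {n k : ℕ} {t : Fin k → Fin n} where

  Respects : (Fin n → Fin k) → Set
  Respects f = ∀ j → f (t j) ≡ j

  fromLabelling : ∀ f → Respects f → MultiterminalCut t
  fromLabelling f f-t = record
    { block    = block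
    ; nonempty = λ j → t j , ∈-block (f-t j)
    ; disjoint = λ v∈i v∈j → trans (sym (block-∈ v∈i)) (block-∈ v∈j)
    ; cover    = λ v → f v , ∈-block refl
    ; terminal = λ j → ∈-block (f-t j)
    }
    where
    block = λ j → tabulate λ v → does (f v ≟ j)

    ∈-block : ∀ {v j} → f v ≡ j → v ∈ block j
    ∈-block {v} {j} eq =
      lookup⇒[]= v _ (trans (lookup∘tabulate _ v) (dec-true (f v ≟ j) eq))

    block-∈ : ∀ {v j} → v ∈ block j → f v ≡ j
    block-∈ {v} {j} v∈ with f v ≟ j | trans (sym (lookup∘tabulate (λ v → does (f v ≟ j)) v)) ([]=⇒lookup v∈)
    ... | yes eq | _ = eq
    ... | no  _  | ()

  label : MultiterminalCut t → Fin n → Fin k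
  label C v = proj₁ (MultiterminalCut.cover C v)

  module _ (C : MultiterminalCut t) where
    open MultiterminalCut C

    -- Disjointness makes the block chosen by `cover` the only one containing `v`.
    ∈⇒label : ∀ {v j} → v ∈ block j → label C v ≡ j
    ∈⇒label {v} = disjoint (proj₂ (cover v))

    label-respects : Respects (label C)
    label-respects j = ∈⇒label (terminal j)

    SameBlock⇔label : ∀ u v → SameBlock C u v ⇔ label C u ≡ label C v
    SameBlock⇔label u v = mk⇔
      (λ (j , u∈ , v∈) → trans (∈⇒label u∈) (sym (∈⇒label v∈)))
      (λ eq → label C v , subst (λ j → u ∈ block j) eq (proj₂ (cover u)) , proj₂ (cover v))

  -- Forces the terminals to their own labels, so that a search over all functions amounts to one
  -- over labellings respecting `t`.
  clamp : (Fin n → Fin k) → Fin n → Fin k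
  clamp f v with any? (λ j → t j ≟ v)
  ... | yes (j , _) = j
  ... | no  _       = f v

  clamp-respects : Injective _≡_ _≡_ t → ∀ f → Respects (clamp f)
  clamp-respects t-inj f j with any? (λ i → t i ≟ t j)
  -- The search may return any index of the same terminal vertex; injectivity identifies it with
  -- `j`.
  ... | yes (i , tᵢ≡tⱼ) = t-inj tᵢ≡tⱼ
  ... | no  ∄           = contradiction (j , refl) ∄

  clamp-cong : ∀ {f g} → f ≗ g → clamp f ≗ clamp g
  clamp-cong f≗g v with any? (λ j → t j ≟ v)
  ... | yes _ = refl
  ... | no  _ = f≗g v

  clamp-id : ∀ {f} → Respects f → clamp f ≗ f
  clamp-id f-t v with any? (λ j → t j ≟ v)
  ... | yes (j , refl) = sym (f-t j)
  ... | no  _          = refl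

-- The weight of a labelling.

module _ {n : ℕ} (G : WeightedGraph n) {k : ℕ} where
  open WeightedGraph G

  -- Ends and labels are separate arguments: merging changes labels on a fixed edge, while the twin
  -- property changes the edge under fixed labels.
  cost : Fin n → Fin n → Fin k → Fin k → ℕ
  cost u v a b = if edge u v ∧ not (does (a ≟ b)) then w u v else 0

  cost-diag : ∀ u v a → cost u v a a ≡ 0
  cost-diag u v a rewrite dec-true (a ≟ a) refl with edge u v
  ... | true  = refl
  ... | false = refl

  cost-swap : ∀ u v a b → cost u v a b ≡ cost v u a b
  cost-swap u v a b rewrite edge-sym u v | w-sym u v = refl

  cost-sym : ∀ u v a b → cost u v a b ≡ cost v u b a
  cost-sym u v a b
    rewrite edge-sym u v | w-sym u v
          | does-⇔ (mk⇔ sym sym) (a ≟ b) (b ≟ a) = refl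

  pairCost : (Fin n → Fin k) → Fin n → Fin n → ℕ
  pairCost f u v = cost u v (f u) (f v)

  weight : (Fin n → Fin k) → ℕ
  weight f = ∑∑ (above (pairCost f))

  weight-cong : ∀ {f g} → f ≗ g → weight f ≡ weight g
  weight-cong f≗g = ∑∑-cong λ u v →
    cong (λ x → if does (u <? v) then x else 0) (cong₂ (cost u v) (f≗g u) (f≗g v))

  double-weight : ∀ f → ∑∑ (pairCost f) ≡ weight f + weight f
  double-weight f = ∑∑-above (pairCost f)
    (λ u v → cost-sym u v (f u) (f v)) (λ u → cost-diag u u (f u))

  cutWeight≡weight : ∀ {t : Fin k → Fin n} (C : MultiterminalCut t) →
                     cutWeight G C ≡ weight (label C)
  cutWeight≡weight C = ∑∑-cong λ u v → trans
    (if-∧ (does (u <? v)))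
    (cong (λ s → if does (u <? v) then if edge u v ∧ not s then w u v else 0 else 0)
      (does-⇔ (SameBlock⇔label C u v) (sameBlock? C u v) (label C u ≟ label C v)))

  minimum-labelling : ∀ {t : Fin k → Fin n} → Injective _≡_ _≡_ t → Fin k →
    ∃ λ f → Respects {t = t} f × (∀ C → weight f ≤ cutWeight {t = t} G C)
  minimum-labelling {t} t-inj j₀
    with f , f-min ← minimal-function (weight ∘ clamp {t = t})
                       (λ f≗g → weight-cong (clamp-cong {t = t} f≗g)) j₀
    = clamp f , clamp-respects t-inj f , λ C →
      subst (weight (clamp f) ≤_)
        (trans (weight-cong (clamp-id (label-respects C))) (sym (cutWeight≡weight C)))
        (f-min (label C))

-- Merging two vertices against transposing them.

redirect : ∀ {n} → Fin n → Fin n → Fin n → Fin n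
redirect x y u = if does (u ≟ x) then y else u

module _ {n : ℕ} (v₁ v₂ : Fin n) where

  -- The last three indices are the images of the first under merging v₂
  -- into v₁, merging v₁ into v₂, and transposing the two.
  data Images : (u p q s : Fin n) → Set where
    at₁  : Images v₁ v₁ v₂ v₂
    at₂  : Images v₂ v₁ v₂ v₁
    away : ∀ {u} → u ≢ v₁ → u ≢ v₂ → Images u u u u

  images : ∀ u → Images u (redirect v₂ v₁ u) (redirect v₁ v₂ u) (transpose v₁ v₂ ⟨$⟩ʳ u)
  images u with u ≟ v₁
  images u | yes refl with u ≟ v₂
  ... | yes refl = at₁
  ... | no  _    = at₁
  images u | no u≢v₁ with u ≟ v₂
  ... | yes refl = at₂
  ... | no  u≢v₂ = away u≢v₁ u≢v₂

  -- Here `d x y` stands for the cost of one fixed edge when its ends carry the labels of `x` and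
  -- `y`. If one end is `v₁` and the other `v₂`, both merges give the ends a common label and the
  -- left side vanishes; otherwise the two sides have the same terms up to order.
  merge-≤-transpose : ∀ {u p q s v p′ q′ s′} (d : Fin n → Fin n → ℕ) → (∀ x → d x x ≡ 0) →
                      Images u p q s → Images v p′ q′ s′ →
                      d p p′ + d q q′ ≤ d u v + d s s′
  merge-≤-transpose d d-diag at₁ at₁ = ≤-refl
  merge-≤-transpose d d-diag at₁ at₂ rewrite d-diag v₁ | d-diag v₂ = z≤n
  merge-≤-transpose d d-diag at₁ (away _ _) = ≤-refl
  merge-≤-transpose d d-diag at₂ at₁ rewrite d-diag v₁ | d-diag v₂ = z≤n
  merge-≤-transpose d d-diag at₂ at₂ = ≤-reflexive (+-comm (d v₁ v₁) _)
  merge-≤-transpose d d-diag at₂ (away {v} _ _) = ≤-reflexive (+-comm (d v₁ v) _)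
  merge-≤-transpose d d-diag (away _ _) at₁ = ≤-refl
  merge-≤-transpose d d-diag (away {u} _ _) at₂ = ≤-reflexive (+-comm (d u v₁) _)
  merge-≤-transpose d d-diag (away _ _) (away _ _) = ≤-refl

-- The exchange argument for twins.

module Twins {n : ℕ} (G : WeightedGraph n) (v₁ v₂ : Fin n)
             (N-twin : WeightedGraph.N G v₁ - v₂ ≡ WeightedGraph.N G v₂ - v₁)
             (w-twin : ∀ v → v ∈ WeightedGraph.N G v₁ - v₂ →
                       WeightedGraph.w G v₁ v ≡ WeightedGraph.w G v₂ v) {k : ℕ} where
  open WeightedGraph G

  σ = transpose v₁ v₂

  edge⇒∈ : ∀ {u v} → edge u v ≡ true → v ∈ N u
  edge⇒∈ {u} {v} e = lookup⇒[]= v _ (trans (lookup∘tabulate (edge u) v) e)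

  ∈⇒edge : ∀ {u v} → v ∈ N u → edge u v ≡ true
  ∈⇒edge {u} {v} v∈ = trans (sym (lookup∘tabulate (edge u) v)) ([]=⇒lookup v∈)

  edge-twin : ∀ {v} → v ≢ v₁ → v ≢ v₂ → edge v₁ v ≡ edge v₂ v
  edge-twin {v} v≢v₁ v≢v₂ = ⇔→≡ {z = true} (mk⇔
    (λ e → ∈⇒edge (p─q⊆p _ _ (subst (v ∈_) N-twin (x∈p∧x≢y⇒x∈p-y (edge⇒∈ e) v≢v₂))))
    (λ e → ∈⇒edge (p─q⊆p _ _ (subst (v ∈_) (sym N-twin) (x∈p∧x≢y⇒x∈p-y (edge⇒∈ e) v≢v₁)))))

  -- Equality of weights is known only at neighbours, so the cases are split on adjacency; on a
  -- non-edge both costs are 0.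
  cost-twin : ∀ {v} → v ≢ v₁ → v ≢ v₂ → ∀ (a b : Fin k) → cost G v₁ v a b ≡ cost G v₂ v a b
  cost-twin {v} v≢v₁ v≢v₂ a b rewrite sym (edge-twin v≢v₁ v≢v₂) with edge v₁ v in e
  ... | false = refl
  ... | true  = cong (λ x → if not (does (a ≟ b)) then x else 0)
                  (w-twin v (x∈p∧x≢y⇒x∈p-y (edge⇒∈ e) v≢v₂))

  -- Away from loops the transposition is a weighted automorphism: it reverses the pair `v₁`, `v₂`
  -- and elsewhere replaces one twin by the other.
  cost-transpose : ∀ {u p q s v p′ q′ s′} → Images v₁ v₂ u p q s → Images v₁ v₂ v p′ q′ s′ →
                   u ≢ v → ∀ (a b : Fin k) → cost G s s′ a b ≡ cost G u v a b
  cost-transpose at₁ at₁ u≢v a b = contradiction refl u≢v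
  cost-transpose at₁ at₂ u≢v a b = cost-swap G v₂ v₁ a b
  cost-transpose at₁ (away x y) u≢v a b = sym (cost-twin x y a b)
  cost-transpose at₂ at₁ u≢v a b = cost-swap G v₁ v₂ a b
  cost-transpose at₂ at₂ u≢v a b = contradiction refl u≢v
  cost-transpose at₂ (away x y) u≢v a b = cost-twin x y a b
  cost-transpose (away {u} x y) at₁ u≢v a b =
    trans (cost-swap G u v₂ a b) (trans (sym (cost-twin x y a b)) (cost-swap G v₁ u a b))
  cost-transpose (away {u} x y) at₂ u≢v a b =
    trans (cost-swap G u v₁ a b) (trans (cost-twin x y a b) (cost-swap G v₂ u a b))
  cost-transpose (away _ _) (away _ _) u≢v a b = refl

  pairCost-transpose : ∀ (f : Fin n → Fin k) → ∑∑ (pairCost G (f ∘ (σ ⟨$⟩ʳ_))) ≡ ∑∑ (pairCost G f)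
  pairCost-transpose f = sym (trans (∑∑-permute (pairCost G f) σ) (∑∑-cong eq))
    where
    eq : ∀ u v → pairCost G f (σ ⟨$⟩ʳ u) (σ ⟨$⟩ʳ v) ≡ pairCost G (f ∘ (σ ⟨$⟩ʳ_)) u v
    eq u v with u ≟ v
    -- A loop has the same label at both ends, so it costs 0 wherever it is moved.
    ... | yes refl = trans (cost-diag G (σ ⟨$⟩ʳ u) (σ ⟨$⟩ʳ u) fσu) (sym (cost-diag G u u fσu))
      where fσu = f (σ ⟨$⟩ʳ u)
    ... | no  u≢v  = cost-transpose (images v₁ v₂ u) (images v₁ v₂ v) u≢v
                      (f (σ ⟨$⟩ʳ u)) (f (σ ⟨$⟩ʳ v))

  merge : ∀ (f : Fin n → Fin k) →
          weight G (f ∘ redirect v₂ v₁) ≤ weight G f ⊎ weight G (f ∘ redirect v₁ v₂) ≤ weight G f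
  merge f = ⊎.map (half f₁) (half f₂) (m+n≤o+o⇒m≤o⊎n≤o (D f) (begin
    D f₁ + D f₂                                        ≡⟨ ∑∑-distrib-+ (pairCost G f₁) _ ⟨
    ∑∑ (λ u v → pairCost G f₁ u v + pairCost G f₂ u v) ≤⟨ ∑∑-mono-≤ (λ u v →
                                                            merge-≤-transpose v₁ v₂
                                                              (λ x y → cost G u v (f x) (f y))
                                                              (λ x → cost-diag G u v (f x))
                                                              (images v₁ v₂ u) (images v₁ v₂ v)) ⟩
    ∑∑ (λ u v → pairCost G f u v + pairCost G fσ u v)  ≡⟨ ∑∑-distrib-+ (pairCost G f) _ ⟩
    D f + D fσ                                         ≡⟨ cong (D f +_) (pairCost-transpose f) ⟩
    D f + D f                                          ∎))
    where
    open ≤-Reasoning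
    D : (Fin n → Fin k) → ℕ
    D g = ∑∑ (pairCost G g)

    f₁ = f ∘ redirect v₂ v₁
    f₂ = f ∘ redirect v₁ v₂
    fσ = f ∘ (σ ⟨$⟩ʳ_)

    half : ∀ g → D g ≤ D f → weight G g ≤ weight G f
    -- Each `D` is twice a `weight`. With equal summands the two alternatives coincide, so the
    -- dichotomy serves as division by 2.
    half g le = reduce (m+n≤o+o⇒m≤o⊎n≤o (weight G f)
      (subst₂ _≤_ (double-weight G g) (double-weight G f) le))

-- From a merged labelling to a minimum cut.

redirect-minimal : ∀ {n} {x y u : Fin n} → x ≢ u → redirect x y u ≡ u
redirect-minimal {x = x} {u = u} x≢u rewrite dec-false (u ≟ x) (x≢u ∘ sym) = refl

redirect-merges : ∀ {n} (x y : Fin n) → redirect x y x ≡ redirect x y y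
redirect-merges x y rewrite dec-true (x ≟ x) refl with does (y ≟ x)
... | true  = refl
... | false = refl

-- Since `ρ` fixes the terminals, `f ∘ ρ` still defines a cut, and its weight is at most a lower
-- bound for all cuts. `ρ` stands for either redirection.
merged-minimum : ∀ {n k} (G : WeightedGraph n) {t : Fin k → Fin n} {v₁ v₂} f →
                 Respects {t = t} f → (∀ C → weight G f ≤ cutWeight {t = t} G C) →
                 ∀ ρ → (∀ j → ρ (t j) ≡ t j) → ρ v₁ ≡ ρ v₂ → weight G (f ∘ ρ) ≤ weight G f →
                 ∃ λ (C : MultiterminalCut t) → IsMinimum G C × SameBlock C v₁ v₂
merged-minimum G {v₁ = v₁} {v₂} f f-t f-min ρ ρ-t ρ-merges le =
  -- `label C` unfolds to `f ∘ ρ`, because `fromLabelling` covers each vertex by its own label.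
  C , (λ C′ → ≤-trans (≤-reflexive (cutWeight≡weight G C)) (≤-trans le (f-min C′)))
    , Equivalence.from (SameBlock⇔label C v₁ v₂) (cong f ρ-merges)
  where C = fromLabelling (f ∘ ρ) λ j → trans (cong f (ρ-t j)) (f-t j)

lemma4 : ∀ {n k : ℕ} (G : WeightedGraph n) (let open WeightedGraph G) →
    k ≥ 1 →
    (t : Fin k → Fin n) → Injective _≡_ _≡_ t →
    (v₁ v₂ : Fin n) →
    (∀ j → v₁ ≢ t j) → (∀ j → v₂ ≢ t j) →
    N v₁ - v₂ ≡ N v₂ - v₁ →
    (∀ v → v ∈ N v₁ - v₂ → w v₁ v ≡ w v₂ v) →
    ∃ λ (C : MultiterminalCut t) → IsMinimum G C × SameBlock C v₁ v₂
lemma4 G (s≤s _) t t-inj v₁ v₂ v₁∉t v₂∉t N-twin w-twin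
  -- Matching on `k ≥ 1` makes the label `zero` available to start the search.
  with f , f-t , f-min ← minimum-labelling G {t = t} t-inj zero
  with Twins.merge G v₁ v₂ N-twin w-twin f
-- Only `v₂` is moved here, and only `v₁` in the other case; neither is a terminal, so all terminals
-- stay fixed.
... | inj₁ le = merged-minimum G f f-t f-min (redirect v₂ v₁)
                  (redirect-minimal ∘ v₂∉t) (sym (redirect-merges v₂ v₁)) le
... | inj₂ le = merged-minimum G f f-t f-min (redirect v₁ v₂)
                  (redirect-minimal ∘ v₁∉t) (redirect-merges v₁ v₂) le
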